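{- Let $\kappa$ be a regular uncountable cardinal and $\lambda>\kappa$ a cardinal. (i) There is an ideal $H$ on $P_\kappa(\lambda)$ such that (a) $\mathfrak a_H=\kappa$, (b) $\mathrm{cof}(H)=\mathfrak d^\kappa_{\kappa,\lambda}$, and (c) $\overline{\mathrm{cof}}(H)\le\overline{\mathfrak d}^\kappa_{\kappa,\lambda}$. (ii) There is an ideal $K$ on $P_\kappa(\lambda)$ such that (a) $K$ is not a weak $\pi$-point, (b) $\mathrm{cof}(K)=\mathfrak d^\kappa_{\kappa,\lambda}$, and (c) $\overline{\mathrm{cof}}(K)\le\overline{\mathfrak d}^\kappa_{\kappa,\lambda}$.
   Context: For a cardinal $\mu$ and a set $A$, $P_\mu(A)=\{a\subseteq A:|a|<\mu\}$. An ideal on an infinite set $S$ is a collection $K$ of subsets of $S$ containing all singletons, closed under subsets and finite unions, with $S\notin K$; $K^+=P(S)\setminus K$. $\mathrm{cof}(K)$ is the least cardinality of an $X\subseteq K$ with $K=\bigcup_{A\in X}P(A)$; $\overline{\mathrm{cof}}(K)$ is the least cardinality of an $X\subseteq K$ with $K=\bigcup\{P(\bigcup x):x\in P_\kappa(X)\}$. $I_{\kappa,\lambda}$ is the set of all $A\subseteq P_\kappa(\lambda)$ such that $A\cap\{b\in P_\kappa(\lambda):a\subseteq b\}=\emptyset$ for some $a\in P_\kappa(\lambda)$. "Ideal on $P_\kappa(\lambda)$" always means an ideal $H$ on $P_\kappa(\lambda)$ that is $\kappa$-complete (closed under unions of fewer than $\kappa$ members) and fine ($I_{\kappa,\lambda}\subseteq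 H$). $\mathfrak d^\kappa_{\kappa,\lambda}$ is the least cardinality of an $F\subseteq{}^\kappa(P_\kappa(\lambda))$ such that for every $g\in{}^\kappa(P_\kappa(\lambda))$ there is $f\in F$ with $g(\alpha)\subseteq f(\alpha)$ for all $\alpha\in\kappa$. $\overline{\mathfrak d}^\kappa_{\kappa,\lambda}$ is the least cardinality of an $X\subseteq{}^\kappa(P_\kappa(\lambda))$ such that for every $g\in{}^\kappa(P_\kappa(\lambda))$ there is $x\in P_\kappa(X)$ with $g(\alpha)\subseteq\bigcup_{f\in x}f(\alpha)$ for every $\alpha<\kappa$. For an ideal $H$ on $P_\kappa(\lambda)$, $\mathcal M_H^{\ge\kappa}$ is the set of all $Q\subseteq H^+$ such that (i) $|Q|\ge\kappa$, (ii) $A\cap B\in H$ for all distinct $A,B\in Q$, and (iii) for every $C\in H^+$ there is $A\in Q$ with $A\cap C\in H^+$. $\mathfrak a_H$ is the least cardinality of a member of $\mathcal M_H^{\ge\kappa}$ if $\mathcal M_H^{\ge\kappa}\neq\emptyset$, and $2^{(\lambda^{<\kappa})^+}$ otherwise. $H$ is a weak $\pi$-point if for every $f\in{}^\kappa H$ and $A\in H^+$ there is $B\in H^+\cap P(A)$ such that $B\cap f(\alpha)\in I_{\kappa,\lambda}$ for every $\alpha\in\kappa$. -}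

module Defs where

open import Axiom.ExcludedMiddle using (ExcludedMiddle)
open import Data.Bool using (Bool; true; not; T; _∧_; _∨_)
open import Data.Nat using (ℕ)
open import Data.Product using (Σ; ∃; _×_)
open import Data.Refinement using (Refinement-syntax; value)
open import Data.Sum using (_⊎_)
open import Function.Bundles using (_↣_; _↔_; _⇔_)
open import Induction.WellFounded using (WellFounded)
open import Level using (Level; suc; _⊔_)
open import Relation.Binary using (Rel; IsStrictTotalOrder)
open import Relation.Binary.PropositionalEquality using (_≡_; _≢_)
open import Relation.Nullary using (¬_; does)

private
  variable
    a b ℓ : Level

-- The ambient theory is classical set theory with choice. Sets are types
-- in a fixed universe Set ℓ; where classical reasoning is needed to form an
-- object, ExcludedMiddle ℓ is a parameter. As Dec P contains an element of P
-- in the positive case, that hypothesis also provides choice functions.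

-- A subset is its characteristic function. Under excluded middle every
-- predicate has one (see ⟨_⟩ below), and the power set of a type stays in
-- the same universe. Under function extensionality _≡_ on 𝒫 A is
-- extensional equality of sets.

𝒫 : Set a → Set a
𝒫 A = A → Bool

infix 4 _∈_ _∉_ _⊆_

_∈_ : {A : Set a} → A → 𝒫 A → Set
x ∈ s = T (s x)

_∉_ : {A : Set a} → A → 𝒫 A → Set
x ∉ s = ¬ (x ∈ s)

_⊆_ : {A : Set a} → 𝒫 A → 𝒫 A → Set a
s ⊆ t = ∀ x → x ∈ s → x ∈ t

infixr 7 _∩_
infixr 6 _∪_

_∩_ _∪_ : {A : Set a} → 𝒫 A → 𝒫 A → 𝒫 A
(s ∩ t) x = s x ∧ t x
(s ∪ t) x = s x ∨ t x

full : {A : Set a} → 𝒫 A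
full _ = true

-- Membership proofs are irrelevant, so elements of El s are equal exactly
-- when their values are.

El : {A : Set a} → 𝒫 A → Set a
El {A = A} s = [ x ∈ A ∣ x ∈ s ]

infix 4 _≼_ _≺_

_≼_ : Set a → Set b → Set (a ⊔ b)
A ≼ B = A ↣ B

_≺_ : Set a → Set b → Set (a ⊔ b)
A ≺ B = A ≼ B × ¬ (B ≼ A)

-- A cardinal is an initial ordinal: a well-ordered set that does not inject
-- into any of its proper initial segments.

record Cardinal ℓ : Set (suc ℓ) where
  field
    ∣_∣                : Set ℓ
    _<_                : Rel ∣_∣ ℓ
    isStrictTotalOrder : IsStrictTotalOrder _≡_ _<_
    wellFounded        : WellFounded _<_

  Below : ∣_∣ → Set ℓ
  Below α = [ β ∈ ∣_∣ ∣ β < α ]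

  field
    initial : ∀ α → ¬ (∣_∣ ≼ Below α)

open Cardinal public using (∣_∣)

Uncountable : Cardinal ℓ → Set ℓ
Uncountable κ = ℕ ≺ ∣ κ ∣

-- κ is infinite and cof(κ) = κ, that is, unbounded subsets have size κ.

Regular : Cardinal ℓ → Set ℓ
Regular κ = ℕ ≼ ∣ κ ∣ × (∀ s → Unbounded s → ∣ κ ∣ ≼ El s)
  where
  open Cardinal κ using (_<_)
  Unbounded : 𝒫 ∣ κ ∣ → Set _
  Unbounded s = ∀ α → ∃ λ β → β ∈ s × ¬ (β < α)

IsSuccessorOf : Cardinal ℓ → Set ℓ → Set (suc ℓ)
IsSuccessorOf {ℓ} σ A = A ≺ ∣ σ ∣ × (∀ (τ : Cardinal ℓ) → A ≺ ∣ τ ∣ → ∣ σ ∣ ≼ ∣ τ ∣)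

-- The set of sequences of length less than κ in A.

_^<_ : Set ℓ → Cardinal ℓ → Set ℓ
A ^< κ = Σ ∣ κ ∣ λ α → Cardinal.Below κ α → A

-- Invariants that are defined as least cardinalities are rendered as
-- relations "the invariant equals μ".

IsLeastCard : {A : Set ℓ} → (𝒫 A → Set ℓ) → Cardinal ℓ → Set ℓ
IsLeastCard Φ μ =
    (∃ λ X → Φ X × (El X ↔ ∣ μ ∣))
  × (∀ X → Φ X → ∣ μ ∣ ≼ El X)

P< : Cardinal ℓ → Set ℓ → Set ℓ
P< κ A = [ s ∈ 𝒫 A ∣ El s ≺ ∣ κ ∣ ]

-- x ∈ P_κ(X) for a subset X of a type.

_∈P<[_]_ : {A : Set ℓ} → 𝒫 A → Cardinal ℓ → 𝒫 A → Set ℓ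
x ∈P<[ κ ] X = x ⊆ X × El x ≺ ∣ κ ∣

module Classical {ℓ} (em : ExcludedMiddle ℓ) where

  ⟨_⟩ : {A : Set ℓ} → (A → Set ℓ) → 𝒫 A
  ⟨ P ⟩ x = does (em {P x})

  ｛_｝ : {A : Set ℓ} → A → 𝒫 A
  ｛ x ｝ = ⟨ (λ y → y ≡ x) ⟩

  ⋃-syntax : {I A : Set ℓ} → 𝒫 I → (I → 𝒫 A) → 𝒫 A
  ⋃-syntax X h = ⟨ (λ y → ∃ λ i → i ∈ X × y ∈ h i) ⟩

  infix 5 ⋃-syntax
  syntax ⋃-syntax X (λ i → s) = ⋃[ i ∈ X ] s

  ⋃ : {A : Set ℓ} → 𝒫 (𝒫 A) → 𝒫 A
  ⋃ X = ⋃[ s ∈ X ] s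

  record IsIdeal {S : Set ℓ} (K : 𝒫 (𝒫 S)) : Set ℓ where
    field
      singletons : ∀ s → ｛ s ｝ ∈ K
      downward   : ∀ A B → A ⊆ B → B ∈ K → A ∈ K
      unions     : ∀ A B → A ∈ K → B ∈ K → (A ∪ B) ∈ K
      proper     : full ∉ K

  infix 10 _⁺

  _⁺ : {S : Set ℓ} → 𝒫 (𝒫 S) → 𝒫 (𝒫 S)
  (K ⁺) A = not (K A)

  Cof : {S : Set ℓ} → 𝒫 (𝒫 S) → Cardinal ℓ → Set ℓ
  Cof K = IsLeastCard λ X →
    X ⊆ K × (∀ B → B ∈ K ⇔ (∃ λ A → A ∈ X × B ⊆ A))

  module Pκλ (κ Λ : Cardinal ℓ) where

    PκΛ : Set ℓ
    PκΛ = P< κ ∣ Λ ∣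

    -- The cofinality with a bar: cof‾(K) = μ. It depends on κ.

    Cof‾ : {S : Set ℓ} → 𝒫 (𝒫 S) → Cardinal ℓ → Set ℓ
    Cof‾ K = IsLeastCard λ X →
      X ⊆ K × (∀ B → B ∈ K ⇔ (∃ λ x → x ∈P<[ κ ] X × B ⊆ ⋃ x))

    Above : PκΛ → 𝒫 PκΛ
    Above a = ⟨ (λ b → value a ⊆ value b) ⟩

    I : 𝒫 (𝒫 PκΛ)
    I = ⟨ (λ A → ∃ λ a → ∀ b → b ∉ A ∩ Above a) ⟩

    record IsIdealOnPκΛ (H : 𝒫 (𝒫 PκΛ)) : Set ℓ where
      field
        isIdeal  : IsIdeal H
        complete : ∀ X → X ∈P<[ κ ] H → ⋃ X ∈ H
        fine     : I ⊆ H

    𝔡 : Cardinal ℓ → Set ℓ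
    𝔡 = IsLeastCard λ (F : 𝒫 (∣ κ ∣ → PκΛ)) →
      ∀ (g : ∣ κ ∣ → PκΛ) → ∃ λ f → f ∈ F × (∀ α → value (g α) ⊆ value (f α))

    𝔡‾ : Cardinal ℓ → Set ℓ
    𝔡‾ = IsLeastCard λ (X : 𝒫 (∣ κ ∣ → PκΛ)) →
      ∀ (g : ∣ κ ∣ → PκΛ) → ∃ λ x →
        x ∈P<[ κ ] X × (∀ α → value (g α) ⊆ (⋃[ f ∈ x ] value (f α)))

    record 𝓜≥κ (H : 𝒫 (𝒫 PκΛ)) (Q : 𝒫 (𝒫 PκΛ)) : Set ℓ where
      field
        positive       : Q ⊆ H ⁺
        large          : ∣ κ ∣ ≼ El Q
        almostDisjoint : ∀ A B → A ∈ Q → B ∈ Q → A ≢ B → (A ∩ B) ∈ H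
        maximal        : ∀ C → C ∈ H ⁺ → ∃ λ A → A ∈ Q × (A ∩ C) ∈ H ⁺

    -- 𝔞_H = μ. The second alternative says that μ = 2^{(λ^{<κ})⁺} in the
    -- case that there is no Q as above.

    𝔞 : 𝒫 (𝒫 PκΛ) → Cardinal ℓ → Set (suc ℓ)
    𝔞 H μ =
        IsLeastCard (𝓜≥κ H) μ
      ⊎ ( ¬ (∃ λ Q → 𝓜≥κ H Q)
        × ∃ λ σ → IsSuccessorOf σ (∣ Λ ∣ ^< κ) × (∣ μ ∣ ↔ 𝒫 ∣ σ ∣) )

    WeakπPoint : 𝒫 (𝒫 PκΛ) → Set ℓ
    WeakπPoint H =
      ∀ (f : ∣ κ ∣ → 𝒫 PκΛ) → (∀ α → f α ∈ H) → ∀ A → A ∈ H ⁺ →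
      ∃ λ B → B ∈ H ⁺ × B ⊆ A × (∀ α → (B ∩ f α) ∈ I)

{-# OPTIONS --safe #-}
module Submission where

-- Split off κ many disjoint cofinal cells in P_κ(λ). Modulo I, a set small on
-- every cell is given by a function g : κ → P_κ(λ), the set consisting of those
-- b in the α-th cell with g(α) ⊈ b, and inclusion of these sets reflects
-- pointwise inclusion of functions up to a change of g. Hence both the ideal H
-- of the sets that are small on every cell and the ideal K of the sets that are
-- small on all but boundedly many cells have the cofinality of the dominating
-- families. The cells form a maximal almost disjoint family for H, by
-- diagonalisation; they lie in K, but a set that meets every cell in a set from
-- I is in K, so K is not a weak π-point.

open import Axiom.ExcludedMiddle using (ExcludedMiddle)
open import Axiom.Extensionality.Propositional using (Extensionality; lower-extensionality)
open import Data.Bool using (Bool; true; false; T; if_then_else_)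
open import Data.Bool.Properties using (T-∧; T-∨; T?)
open import Data.Empty using (⊥-elim)
open import Data.Irrelevant using ([_])
open import Data.Maybe using (Maybe; just; nothing)
open import Data.Maybe.Properties using (just-injective)
open import Data.Nat using (ℕ)
open import Data.Product using (∃; _×_; _,_; proj₁; proj₂)
open import Data.Refinement using (Refinement-syntax; value; _,_)
open import Data.Refinement.Properties using (value-injective)
open import Data.Sum using (_⊎_; inj₁; inj₂)
open import Data.Unit using (tt)
open import Function.Base using (id; _∘_)
open import Function.Bundles using (_↣_; _↔_; _⇔_; mk↣; mk↔ₛ′; mk⇔; module Injection; module Equivalence)
open import Function.Construct.Composition using (_↣-∘_)
open import Function.Construct.Identity using (↔-id)
open import Function.Properties.Inverse using (↔⇒↣)
open import Induction.WellFounded using (WellFounded; Acc; acc; module All; module FixPoint)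
open import Level using (Level; Lift; lift; lower)
import Relation.Binary.Construct.On as On
open import Relation.Binary using (Rel; IsStrictTotalOrder; tri<; tri≈; tri>)
open import Relation.Binary.PropositionalEquality using (_≡_; _≢_; refl; sym; trans; cong; subst; isEquivalence; resp₂)
open import Relation.Nullary using (yes; no; ¬_; does; contradiction; recompute)
open import Relation.Nullary.Decidable using (decidable-stable)
open import Defs

-- Classical logic, subsets and images.

module SetTheory {ℓ : Level} (em : ExcludedMiddle ℓ) (ext : Extensionality ℓ ℓ) where
  open Classical em

  holds⁺ : {P : Set ℓ} → P → T (does (em {P}))
  holds⁺ {P} p with em {P}
  ... | yes _ = tt
  ... | no ¬p = ¬p p

  holds⁻ : {P : Set ℓ} → T (does (em {P})) → P
  holds⁻ {P} t with yes p ← em {P} = p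

  dne : {P : Set ℓ} → ¬ ¬ P → P
  dne = decidable-stable em

  ∈-dec : {A : Set ℓ} (x : A) (s : 𝒫 A) → x ∈ s ⊎ x ∉ s
  ∈-dec x s with T? (s x)
  ... | yes p = inj₁ p
  ... | no ¬p = inj₂ ¬p

  𝒫-ext : {A : Set ℓ} {s t : 𝒫 A} → s ⊆ t → t ⊆ s → s ≡ t
  𝒫-ext {s = s} {t} s⊆t t⊆s = lower-extensionality ℓ ℓ ext λ x → bool-ext (s x) (t x) (s⊆t x) (t⊆s x)
    where
    bool-ext : ∀ a b → (T a → T b) → (T b → T a) → a ≡ b
    bool-ext true  true  _ _ = refl
    bool-ext true  false f _ = ⊥-elim (f tt)
    bool-ext false true  _ g = ⊥-elim (g tt)
    bool-ext false false _ _ = refl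

  -- `El s` stores membership irrelevantly; it can be recovered because `T` of a Boolean is
  -- decidable.
  member : {A : Set ℓ} {s : 𝒫 A} (x : El s) → value x ∈ s
  member {s = s} (x , [ p ]) = recompute (T? (s x)) p

  element : {A : Set ℓ} {s : 𝒫 A} (x : A) → x ∈ s → El s
  element x p = x , [ p ]

  image : {A B : Set ℓ} → (A → B) → 𝒫 A → 𝒫 B
  image h X = ⟨ (λ y → ∃ λ x → x ∈ X × h x ≡ y) ⟩

  image-≼ : {A B : Set ℓ} (h : A → B) (X : 𝒫 A) → El (image h X) ≼ El X
  image-≼ h X = mk↣ {to = preimage} inj
    where
    witness : (y : El (image h X)) → ∃ λ x → x ∈ X × h x ≡ value y
    witness y = holds⁻ (member y)
    preimage : El (image h X) → El X
    preimage y = element (proj₁ (witness y)) (proj₁ (proj₂ (witness y)))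
    inj : ∀ {y z} → preimage y ≡ preimage z → y ≡ z
    inj {y} {z} eq = value-injective
      (trans (sym (proj₂ (proj₂ (witness y)))) (trans (cong (h ∘ value) eq) (proj₂ (proj₂ (witness z)))))

  singleton-≼ : {A : Set ℓ} (x : A) → El ｛ x ｝ ≼ ℕ
  singleton-≼ x = mk↣ {to = λ _ → 0} λ {y} {z} _ →
    value-injective (trans (holds⁻ (member y)) (sym (holds⁻ (member z))))

  -- The Cantor-Bernstein theorem.

  module CantorBernstein {A B : Set ℓ} (A≼B : A ≼ B) (B≼A : B ≼ A) where
    open Injection A≼B using () renaming (to to f; injective to f-inj)
    open Injection B≼A using () renaming (to to g; injective to g-inj)

    -- Elements whose backward orbit under f and g stops in A.
    data Rooted : A → Set ℓ where
      root : ∀ {a} → ¬ (∃ λ b → g b ≡ a) → Rooted a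
      step : ∀ {a} → Rooted a → Rooted (g (f a))

    unrooted : ∀ {a} → ¬ Rooted a → ∃ λ b → g b ≡ a
    unrooted ¬r = dne λ ¬b → ¬r (root ¬b)

    -- An element in the range of `g` cannot be a root, so it arises by a step, and injectivity of
    -- `g` identifies its `g`-preimage as a value of `f`. The equation stands in for matching on the
    -- index `g b`, which is not a constructor form.
    rooted-g : ∀ {b a} → a ≡ g b → Rooted a → ∃ λ a′ → Rooted a′ × f a′ ≡ b
    rooted-g eq (root ¬b) = contradiction (_ , sym eq) ¬b
    rooted-g eq (step r)  = _ , r , g-inj eq

    to : A → B
    to a with em {Rooted a}
    ... | yes _ = f a
    ... | no ¬r = proj₁ (unrooted ¬r)

    from : B → A
    from b with em {Rooted (g b)}
    ... | yes r = proj₁ (rooted-g refl r)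
    ... | no _  = g b

    to∘from : ∀ b → to (from b) ≡ b
    to∘from b with em {Rooted (g b)}
    to∘from b | yes r with rooted-g refl r
    ... | a , ra , fa≡b with em {Rooted a}
    ...   | yes _ = fa≡b
    ...   | no ¬r = contradiction ra ¬r
    to∘from b | no ¬r with em {Rooted (g b)}
    ... | yes r   = contradiction r ¬r
    ... | no  ¬r′ = g-inj (proj₂ (unrooted ¬r′))

    from∘to : ∀ a → from (to a) ≡ a
    from∘to a with em {Rooted a}
    from∘to a | yes r with em {Rooted (g (f a))}
    ... | yes r′ = f-inj (proj₂ (proj₂ (rooted-g refl r′)))
    ... | no ¬r′ = contradiction (step r) ¬r′
    from∘to a | no ¬r with unrooted ¬r
    ... | b , refl with em {Rooted (g b)}
    ...   | yes r = contradiction r ¬r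
    ...   | no _  = refl

  cantor-bernstein : {A B : Set ℓ} → A ≼ B → B ≼ A → A ↔ B
  cantor-bernstein A≼B B≼A = mk↔ₛ′ to from to∘from from∘to
    where open CantorBernstein A≼B B≼A

  -- Well-orders, their comparison with arbitrary sets, and the well-ordering theorem.

  record IsWellOrder {W : Set ℓ} (_<_ : Rel W ℓ) : Set ℓ where
    field
      isStrictTotalOrder : IsStrictTotalOrder _≡_ _<_
      wellFounded        : WellFounded _<_

  module WellOrder {W : Set ℓ} {_<_ : Rel W ℓ} (wo : IsWellOrder _<_) where
    open IsWellOrder wo public
    open IsStrictTotalOrder isStrictTotalOrder public using (compare; irrefl) renaming (trans to <-trans)

    Below : W → Set ℓ
    Below α = [ β ∈ W ∣ β < α ]

    below : ∀ {α} (β : Below α) → value β < α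
    below (β , [ p ]) = recompute em p

    minimal : (P : W → Set ℓ) → ∃ P → ∃ λ α → P α × (∀ β → β < α → ¬ P β)
    minimal P (α , p) = dne λ none → All.wfRec wellFounded ℓ (λ α → Lift ℓ (¬ P α))
      (λ α ih → lift λ p → none (α , p , λ β β<α → lower (ih β<α))) α .lower p

    Below-isWellOrder : ∀ α → IsWellOrder {Below α} (λ β γ → value β < value γ)
    Below-isWellOrder α = record
      { isStrictTotalOrder = record
        { isStrictPartialOrder = record
          { isEquivalence = isEquivalence
          ; irrefl        = λ eq → irrefl (cong value eq)
          ; trans         = <-trans
          ; <-resp-≈      = resp₂ _
          }
        ; compare = cmp
        }
      ; wellFounded = On.wellFounded value wellFounded
      }
      where
      cmp : (β γ : Below α) → _
      cmp β γ with compare (value β) (value γ)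
      ... | tri< a ¬b ¬c = tri< a (¬b ∘ cong value) ¬c
      ... | tri≈ ¬a b ¬c = tri≈ ¬a (value-injective b) ¬c
      ... | tri> ¬a ¬b c = tri> ¬a (¬b ∘ cong value) c

    -- Enumerate Y along W for as long as there are new elements.
    module Comparison (Y : Set ℓ) where

      next : ∀ α → (∀ {β} → β < α → Maybe Y) → Maybe Y
      next α e with em {∃ λ y → ∀ {β} (β<α : β < α) → e β<α ≢ just y}
      ... | yes (y , _) = just y
      ... | no _        = nothing

      -- Needed to unfold the recursion that defines `enum`. The history has an implicit argument,
      -- so extensionality is applied to its explicit form.
      next-ext : ∀ α {e e′ : ∀ {β} → β < α → Maybe Y} →
                 (∀ {β} (β<α : β < α) → e β<α ≡ e′ β<α) → next α e ≡ next α e′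
      next-ext α eq = cong {A = ∀ β → β < α → Maybe Y} (λ e → next α (e _)) (ext λ β → ext λ β<α → eq β<α)

      enum : W → Maybe Y
      enum = All.wfRec wellFounded ℓ (λ _ → Maybe Y) next

      enum-next : ∀ α → enum α ≡ next α (λ {β} _ → enum β)
      enum-next α = FixPoint.unfold-wfRec wellFounded (λ _ → Maybe Y) next next-ext

      enum-new : ∀ {α y β} → enum α ≡ just y → β < α → enum β ≢ just y
      enum-new {α} eq β<α with em {∃ λ y → ∀ {β} (β<α : β < α) → enum β ≢ just y} | trans (sym (enum-next α)) eq
      ... | yes (_ , new) | refl = new β<α

      enum-all : ∀ {α} → enum α ≡ nothing → ∀ y → ∃ λ β → β < α × enum β ≡ just y
      enum-all {α} eq y with em {∃ λ y → ∀ {β} (β<α : β < α) → enum β ≢ just y} | trans (sym (enum-next α)) eq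
      ... | no ¬new | _ = dne λ none → ¬new (y , λ β<α e → none (_ , β<α , e))

      -- The enumeration never repeats a value. If it never stops, it injects `W` into `Y`; if it
      -- stops at `α`, then `Y` was exhausted before `α`, and each element goes to a stage at which
      -- it was listed.
      comparison : W ≼ Y ⊎ ∃ λ α → Y ≼ Below α
      comparison with em {∃ λ α → enum α ≡ nothing}
      ... | yes (α , eq) = inj₂ (α , mk↣ {to = index} λ {y} {z} i≡j → just-injective
              (trans (sym (enum-index y)) (trans (cong (enum ∘ value) i≡j) (enum-index z))))
        where
        index : Y → Below α
        index y = proj₁ (enum-all eq y) , [ proj₁ (proj₂ (enum-all eq y)) ]
        enum-index : ∀ y → enum (value (index y)) ≡ just y
        enum-index y = proj₂ (proj₂ (enum-all eq y))
      ... | no total = inj₁ (mk↣ {to = λ α → proj₁ (val α)} inj)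
        where
        val : ∀ α → ∃ λ y → enum α ≡ just y
        val α with enum α in eq
        ... | just y  = y , refl
        ... | nothing = contradiction (α , eq) total
        inj : ∀ {α β} → proj₁ (val α) ≡ proj₁ (val β) → α ≡ β
        inj {α} {β} eq with compare α β
        ... | tri≈ _ α≡β _ = α≡β
        ... | tri< α<β _ _ = contradiction (trans (proj₂ (val α)) (cong just eq)) (enum-new (proj₂ (val β)) α<β)
        ... | tri> _ _ β<α = contradiction (trans (proj₂ (val β)) (cong just (sym eq))) (enum-new (proj₂ (val α)) β<α)

    open Comparison public using (comparison)

  -- Zermelo's well-ordering: y precedes z if some stage of the tower contains y but not z.
  module Zermelo (Y : Set ℓ) where

    pick : 𝒫 Y → Maybe Y
    pick s with em {∃ λ y → Lift ℓ (y ∉ s)}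
    ... | yes (y , _) = just y
    ... | no _        = nothing

    pick-new : ∀ {s y} → pick s ≡ just y → y ∉ s
    pick-new {s} eq with em {∃ λ y → Lift ℓ (y ∉ s)} | eq
    ... | yes (_ , y∉s) | refl = lower y∉s

    pick-just : ∀ {s y} → y ∉ s → ∃ λ z → pick s ≡ just z
    pick-just {s} y∉s with em {∃ λ y → Lift ℓ (y ∉ s)}
    ... | yes (z , _) = z , refl
    ... | no full     = contradiction (_ , lift y∉s) full

    next : 𝒫 Y → 𝒫 Y
    next s = ⟨ (λ y → y ∈ s ⊎ pick s ≡ just y) ⟩

    ⊆-next : ∀ s → s ⊆ next s
    ⊆-next s y y∈s = holds⁺ (inj₁ y∈s)

    -- The tower starts at the empty set, which is the union of the empty family.
    data Tower : 𝒫 Y → Set ℓ where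
      succ  : ∀ {s} → Tower s → Tower (next s)
      union : ∀ {F} → (∀ s → s ∈ F → Tower s) → Tower (⋃ F)

    -- Induction on both stages. For a successor, `s` and `t` are compared in both orders; if each
    -- is contained in the other, they are equal and so are their successors.
    linear : ∀ {s t} → Tower s → Tower t → s ⊆ t ⊎ next t ⊆ s
    linear {t = t} (union {F} f) Tt with em {∃ λ s → s ∈ F × next t ⊆ s}
    ... | yes (s , s∈F , t⊆s) = inj₂ λ y y∈t → holds⁺ (s , s∈F , t⊆s y y∈t)
    ... | no none = inj₁ λ y y∈⋃F → helper y (holds⁻ y∈⋃F)
      where
      helper : ∀ y → (∃ λ s → s ∈ F × y ∈ s) → y ∈ t
      helper y (s , s∈F , y∈s) with linear (f s s∈F) Tt
      ... | inj₁ s⊆t = s⊆t y y∈s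
      ... | inj₂ t⊆s = contradiction (s , s∈F , t⊆s) none
    linear {t = t} (succ {s} Ts) Tt with linear Ts Tt | linear Tt Ts
    ... | inj₂ t⊆s | _        = inj₂ λ y → ⊆-next s y ∘ t⊆s y
    ... | inj₁ _   | inj₂ s⊆t = inj₁ s⊆t
    ... | inj₁ s⊆t | inj₁ t⊆s = inj₂ (subst (λ u → next t ⊆ next u) (𝒫-ext t⊆s s⊆t) λ _ → id)

    chain : ∀ {s t} → Tower s → Tower t → s ⊆ t ⊎ t ⊆ s
    chain {t = t} Ts Tt with linear Ts Tt
    ... | inj₁ s⊆t = inj₁ s⊆t
    ... | inj₂ t⊆s = inj₂ λ y → t⊆s y ∘ ⊆-next t y

    Stage : Y → 𝒫 Y → Set ℓ
    Stage y s = Tower s × y ∉ s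

    -- The largest stage that omits `y`.
    stage : Y → 𝒫 Y
    stage y = ⋃ ⟨ Stage y ⟩

    stage-tower : ∀ y → Tower (stage y)
    stage-tower y = union λ s s∈ → proj₁ (holds⁻ {Stage y s} s∈)

    ∉-stage : ∀ y → y ∉ stage y
    ∉-stage y y∈ with holds⁻ y∈
    ... | s , s∈ , y∈s = proj₂ (holds⁻ {Stage y s} s∈) y∈s

    -- If the successor of `stage y` still omitted `y`, maximality would put it inside `stage y`,
    -- although it contains a newly picked element. So `y` is in the successor, and it is the only
    -- element added there.
    pick-stage : ∀ y → pick (stage y) ≡ just y
    pick-stage y with ∈-dec y (next (stage y))
    ... | inj₂ y∉ with pick-just (∉-stage y)
    ...   | z , eq = contradiction z∈stage (pick-new eq)
      where
      z∈stage : z ∈ stage y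
      z∈stage = holds⁺ {∃ λ s → s ∈ ⟨ Stage y ⟩ × z ∈ s}
        (next (stage y) , holds⁺ {Stage y _} (succ (stage-tower y) , y∉) , holds⁺ {_ ⊎ _} (inj₂ eq))
    pick-stage y | inj₁ y∈ with holds⁻ y∈
    ...   | inj₁ y∈s = contradiction y∈s (∉-stage y)
    ...   | inj₂ eq  = eq

    _<_ : Rel Y ℓ
    y < z = ∃ λ s → Tower s × y ∈ s × z ∉ s

    <-trans : ∀ {x y z} → x < y → y < z → x < z
    <-trans {x} {y} (s , Ts , x∈s , y∉s) (t , Tt , y∈t , z∉t) with chain Ts Tt
    ... | inj₁ s⊆t = t , Tt , s⊆t x x∈s , z∉t
    ... | inj₂ t⊆s = contradiction (t⊆s y y∈t) y∉s

    <-irrefl : ∀ {y} → ¬ (y < y)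
    <-irrefl (s , _ , y∈s , y∉s) = y∉s y∈s

    connected : ∀ y z → y ≢ z → y < z ⊎ z < y
    connected y z y≢z with ∈-dec z (stage y)
    ... | inj₁ z∈ = inj₂ (stage y , stage-tower y , z∈ , ∉-stage y)
    ... | inj₂ z∉ = inj₁ (next (stage y) , succ (stage-tower y) , holds⁺ (inj₂ (pick-stage y)) , z∉next ∘ holds⁻)
      where
      z∉next : ¬ (z ∈ stage y ⊎ pick (stage y) ≡ just z)
      z∉next (inj₁ z∈) = z∉ z∈
      z∉next (inj₂ eq) = y≢z (just-injective (trans (sym (pick-stage y)) eq))

    -- Induction on the stage. When `y` is the element added to `s`, a predecessor of `y` lies in a
    -- stage without `y`, and by linearity that stage is contained in `s`.
    tower-accessible : ∀ {s} → Tower s → ∀ y → y ∈ s → Acc _<_ y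
    tower-accessible (union f) y y∈ with holds⁻ y∈
    ... | s , s∈F , y∈s = tower-accessible (f s s∈F) y y∈s
    tower-accessible (succ {s} Ts) y y∈ with holds⁻ y∈
    ... | inj₁ y∈s = tower-accessible Ts y y∈s
    ... | inj₂ eq  = acc λ { {z} (t , Tt , z∈t , y∉t) → helper z t z∈t y∉t (linear Tt Ts) }
      where
      helper : ∀ z t → z ∈ t → y ∉ t → t ⊆ s ⊎ next s ⊆ t → Acc _<_ z
      helper z t z∈t _   (inj₁ t⊆s) = tower-accessible Ts z (t⊆s z z∈t)
      helper z t _   y∉t (inj₂ s⊆t) = contradiction (s⊆t y (holds⁺ (inj₂ eq))) y∉t

    isWellOrder : IsWellOrder _<_
    isWellOrder = record
      { isStrictTotalOrder = record
        { isStrictPartialOrder = record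
          { isEquivalence = isEquivalence
          ; irrefl        = λ { refl → <-irrefl }
          ; trans         = <-trans
          ; <-resp-≈      = resp₂ _<_
          }
        ; compare = cmp
        }
      ; wellFounded = λ y → tower-accessible (succ (stage-tower y)) y (holds⁺ (inj₂ (pick-stage y)))
      }
      where
      cmp : (y z : Y) → _
      cmp y z with em {y ≡ z}
      ... | yes refl = tri≈ <-irrefl refl <-irrefl
      ... | no y≢z with connected y z y≢z
      ...   | inj₁ y<z = tri< y<z y≢z λ z<y → <-irrefl (<-trans y<z z<y)
      ...   | inj₂ z<y = tri> (λ y<z → <-irrefl (<-trans y<z z<y)) y≢z z<y

  -- Existence and comparison of least cardinalities.

  -- Well-order `Y i₀`. If no `Y i` injects into a proper initial segment, `Y i₀` is itself an
  -- initial ordinal and a lower bound. Otherwise the least segment receiving some `Y i` is one, and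
  -- it is equinumerous with that `Y i`.
  least-cardinality : {I : Set ℓ} (Y : I → Set ℓ) → I →
    ∃ λ (μ : Cardinal ℓ) → (∃ λ i → Y i ↔ ∣ μ ∣) × (∀ i → ∣ μ ∣ ≼ Y i)
  least-cardinality {I} Y i₀ with em {∃ λ α → ∃ λ i → Y i ≼ WellOrder.Below (Zermelo.isWellOrder (Y i₀)) α}
  ... | no none = μ , (i₀ , ↔-id _) , bound
    where
    open WellOrder (Zermelo.isWellOrder (Y i₀))
    μ : Cardinal ℓ
    μ = record
      { isStrictTotalOrder = isStrictTotalOrder
      ; wellFounded        = wellFounded
      ; initial            = λ α Y≼α → none (α , i₀ , Y≼α)
      }
    bound : ∀ i → Y i₀ ≼ Y i
    bound i with comparison (Y i)
    ... | inj₁ ≼Yi       = ≼Yi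
    ... | inj₂ (α , ≼α) = contradiction (α , i , ≼α) none
  ... | yes some = μ , (i , cantor-bernstein Yi≼α (bound i)) , bound
    where
    module W = WellOrder (Zermelo.isWellOrder (Y i₀))
    least = W.minimal (λ α → ∃ λ i → Y i ≼ W.Below α) some
    α = proj₁ least
    i = proj₁ (proj₁ (proj₂ least))
    Yi≼α = proj₂ (proj₁ (proj₂ least))
    open WellOrder (W.Below-isWellOrder α)
    Below-≼ : ∀ β → Below β ≼ W.Below (value β)
    Below-≼ β = mk↣ {to = λ γ → value (value γ) , [ below {β} γ ]} λ eq → value-injective (value-injective (cong value eq))
    bound : ∀ j → W.Below α ≼ Y j
    bound j with comparison (Y j)
    ... | inj₁ ≼Yj      = ≼Yj
    ... | inj₂ (β , ≼β) = contradiction (j , Below-≼ β ↣-∘ ≼β) (proj₂ (proj₂ least) (value β) (W.below β))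
    μ : Cardinal ℓ
    μ = record
      { isStrictTotalOrder = isStrictTotalOrder
      ; wellFounded        = wellFounded
      ; initial            = λ β α≼β → proj₂ (proj₂ least) (value β) (W.below β) (i , Below-≼ β ↣-∘ (α≼β ↣-∘ Yi≼α))
      }

  opaque
    leastCard-exists : {A : Set ℓ} {Φ : 𝒫 A → Set ℓ} → ∃ Φ → ∃ (IsLeastCard Φ)
    leastCard-exists {Φ = Φ} ∃Φ with least-cardinality {∃ Φ} (El ∘ proj₁) ∃Φ
    ... | μ , ((X , ΦX) , X↔μ) , bound = μ , (X , ΦX , X↔μ) , λ X ΦX → bound (X , ΦX)

  -- One such conversion bounds the invariant of `Ψ` by that of `Φ`; conversions in both directions
  -- make the invariants equal.
  _⇝_ : {A B : Set ℓ} → (𝒫 A → Set ℓ) → (𝒫 B → Set ℓ) → Set ℓ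
  Φ ⇝ Ψ = ∀ X → Φ X → ∃ λ Y → Ψ Y × El Y ≼ El X

  leastCard-≼ : {A B : Set ℓ} {Φ : 𝒫 A → Set ℓ} {Ψ : 𝒫 B → Set ℓ} {μ ν : Cardinal ℓ} →
    Φ ⇝ Ψ → IsLeastCard Φ μ → IsLeastCard Ψ ν → ∣ ν ∣ ≼ ∣ μ ∣
  leastCard-≼ Φ⇝Ψ ((X , ΦX , X↔μ) , _) (_ , bound) with Φ⇝Ψ X ΦX
  ... | Y , ΨY , Y≼X = ↔⇒↣ X↔μ ↣-∘ (Y≼X ↣-∘ bound Y ΨY)

  leastCard-transfer : {A B : Set ℓ} {Φ : 𝒫 A → Set ℓ} {Ψ : 𝒫 B → Set ℓ} {μ : Cardinal ℓ} →
    Φ ⇝ Ψ → Ψ ⇝ Φ → IsLeastCard Φ μ → IsLeastCard Ψ μ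
  leastCard-transfer {B = B} {Ψ = Ψ} {μ} Φ⇝Ψ Ψ⇝Φ ((X , ΦX , X↔μ) , bound) with Φ⇝Ψ X ΦX
  ... | Y , ΨY , Y≼X =
    (Y , ΨY , cantor-bernstein (↔⇒↣ X↔μ ↣-∘ Y≼X) (bound′ Y ΨY)) , bound′
    where
    bound′ : (Y : 𝒫 B) → Ψ Y → ∣ μ ∣ ≼ El Y
    bound′ Y ΨY with Ψ⇝Φ Y ΨY
    ... | X′ , ΦX′ , X′≼Y = X′≼Y ↣-∘ bound X′ ΦX′

-- Small sets for a regular cardinal, and unions in P_κ(λ).

module Construction {ℓ : Level} (em : ExcludedMiddle ℓ) (ext : Extensionality ℓ ℓ) (κ Λ : Cardinal ℓ)
  (regular : Regular κ) (uncountable : Uncountable κ) (κ≺Λ : ∣ κ ∣ ≺ ∣ Λ ∣) where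

  open Classical em
  open Pκλ κ Λ
  open SetTheory em ext
  open Cardinal κ using (_<_; initial)

  isWellOrder : IsWellOrder _<_
  isWellOrder = record { Cardinal κ }

  open WellOrder isWellOrder using (Below; below; comparison; compare; irrefl; <-trans)

  ≼-small : {A B : Set ℓ} → A ≼ B → B ≺ ∣ κ ∣ → A ≺ ∣ κ ∣
  ≼-small A≼B (B≼κ , κ⋠B) = B≼κ ↣-∘ A≼B , λ κ≼A → κ⋠B (A≼B ↣-∘ κ≼A)

  Below-≼ : ∀ α → Below α ≼ ∣ κ ∣
  Below-≼ α = mk↣ {to = value} value-injective

  small : {A : Set ℓ} → ¬ (∣ κ ∣ ≼ A) → A ≺ ∣ κ ∣
  small {A} κ⋠A with comparison A
  ... | inj₁ κ≼A       = contradiction κ≼A κ⋠A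
  ... | inj₂ (α , A≼α) = Below-≼ α ↣-∘ A≼α , κ⋠A

  Below-small : ∀ α → Below α ≺ ∣ κ ∣
  Below-small α = Below-≼ α , initial α

  countable-small : {A : Set ℓ} → A ≼ ℕ → A ≺ ∣ κ ∣
  countable-small A≼ℕ = small λ κ≼A → proj₂ uncountable (A≼ℕ ↣-∘ κ≼A)

  opaque
    bounded : (s : 𝒫 ∣ κ ∣) → ¬ (∣ κ ∣ ≼ El s) → ∃ λ α → ∀ β → β ∈ s → β < α
    bounded s κ⋠s = dne λ unbounded → κ⋠s (proj₂ regular s λ α → dne λ none →
      unbounded (α , λ β β∈s → dne λ β≮α → none (β , β∈s , β≮α)))

    union-small : {J A : Set ℓ} (h : J → 𝒫 A) → J ≺ ∣ κ ∣ → (∀ j → El (h j) ≺ ∣ κ ∣) →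
      El ⟨ (λ x → ∃ λ j → x ∈ h j) ⟩ ≺ ∣ κ ∣
    union-small {J} h J≺κ h≺κ = small not-large
      where
      not-large : ¬ (∣ κ ∣ ≼ El ⟨ (λ x → ∃ λ j → x ∈ h j) ⟩)
      not-large κ≼⋃ = irrefl refl (<-trans α<sup sup<α)
        where
        open Injection κ≼⋃ using (to; injective)
        fibre : J → 𝒫 ∣ κ ∣
        fibre j β = h j (value (to β))
        fibre-≼ : ∀ j → El (fibre j) ≼ El (h j)
        fibre-≼ j = mk↣ {to = λ β → element (value (to (value β))) (member β)}
          λ eq → value-injective (injective (value-injective (cong value eq)))
        sup : ∀ j → ∃ λ α → ∀ β → β ∈ fibre j → β < α
        sup j = bounded (fibre j) λ κ≼fibre → proj₂ (h≺κ j) (fibre-≼ j ↣-∘ κ≼fibre)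
        sups : 𝒫 ∣ κ ∣
        sups = image (proj₁ ∘ sup) full
        El-full : El (full {A = J}) ≼ J
        El-full = mk↣ {to = value} value-injective
        sup-sups : ∃ λ α → ∀ β → β ∈ sups → β < α
        sup-sups = bounded sups λ κ≼sups → proj₂ J≺κ (El-full ↣-∘ (image-≼ (proj₁ ∘ sup) full ↣-∘ κ≼sups))
        -- The common bound `α` is an index too: `to α` lies in some `h j`, so `α` is below the
        -- bound of that fibre, which is below `α`.
        α : ∣ κ ∣
        α = proj₁ sup-sups
        index : ∃ λ j → value (to α) ∈ h j
        index = holds⁻ (member (to α))
        α<sup : α < proj₁ (sup (proj₁ index))
        α<sup = proj₂ (sup (proj₁ index)) α (proj₂ index)
        sup<α : proj₁ (sup (proj₁ index)) < α
        sup<α = proj₂ sup-sups (proj₁ (sup (proj₁ index))) (holds⁺ (proj₁ index , tt , refl))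

  size : (a : PκΛ) → El (value a) ≺ ∣ κ ∣
  size (_ , [ p ]) = recompute em p

  opaque
    ⋃ₚ : {J : Set ℓ} → J ≺ ∣ κ ∣ → (J → PκΛ) → PκΛ
    ⋃ₚ J≺κ h = ⟨ (λ x → ∃ λ j → x ∈ value (h j)) ⟩ , [ union-small (value ∘ h) J≺κ (size ∘ h) ]

    ⋃ₚ⁺ : {J : Set ℓ} {J≺κ : J ≺ ∣ κ ∣} (h : J → PκΛ) (j : J) → value (h j) ⊆ value (⋃ₚ J≺κ h)
    ⋃ₚ⁺ h j x x∈ = holds⁺ (j , x∈)

    ⋃ₚ⁻ : {J : Set ℓ} {J≺κ : J ≺ ∣ κ ∣} (h : J → PκΛ) {x : ∣ Λ ∣} → x ∈ value (⋃ₚ J≺κ h) → ∃ λ j → x ∈ value (h j)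
    ⋃ₚ⁻ h = holds⁻

    ｛_｝ₚ : ∣ Λ ∣ → PκΛ
    ｛ x ｝ₚ = ｛ x ｝ , [ countable-small (singleton-≼ x) ]

    ｛｝ₚ⁺ : ∀ x → x ∈ value ｛ x ｝ₚ
    ｛｝ₚ⁺ x = holds⁺ refl

    ｛｝ₚ⁻ : ∀ {x y} → y ∈ value ｛ x ｝ₚ → y ≡ x
    ｛｝ₚ⁻ = holds⁻

    Two-small : Lift ℓ Bool ≺ ∣ κ ∣
    Two-small = countable-small (mk↣ {to = λ b → if lower b then 0 else 1} injective)
      where
      injective : ∀ {b c : Lift ℓ Bool} → (if lower b then 0 else 1) ≡ (if lower c then 0 else 1) → b ≡ c
      injective {lift true}  {lift true}  _ = refl
      injective {lift false} {lift false} _ = refl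

  infixr 6 _∪ₚ_
  opaque
    _∪ₚ_ : PκΛ → PκΛ → PκΛ
    a ∪ₚ b = ⋃ₚ Two-small λ c → if lower c then a else b

    ∪ₚ⁺ˡ : ∀ a b → value a ⊆ value (a ∪ₚ b)
    ∪ₚ⁺ˡ a b = ⋃ₚ⁺ (λ c → if lower c then a else b) (lift true)

    ∪ₚ⁺ʳ : ∀ a b → value b ⊆ value (a ∪ₚ b)
    ∪ₚ⁺ʳ a b = ⋃ₚ⁺ (λ c → if lower c then a else b) (lift false)

    ∪ₚ⁻ : ∀ a b x → x ∈ value (a ∪ₚ b) → x ∈ value a ⊎ x ∈ value b
    ∪ₚ⁻ a b x x∈ with ⋃ₚ⁻ (λ c → if lower c then a else b) x∈
    ... | lift true  , x∈a = inj₁ x∈a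
    ... | lift false , x∈b = inj₂ x∈b

  fresh : (a : PκΛ) → ∃ λ x → x ∉ value a
  fresh a = dne λ none → proj₂ κ≺Λ (proj₁ (size a) ↣-∘ mk↣ {to = λ x → element x (all none x)} (cong value))
    where
    all : ¬ (∃ λ x → x ∉ value a) → ∀ x → x ∈ value a
    all none x with ∈-dec x (value a)
    ... | inj₁ x∈ = x∈
    ... | inj₂ x∉ = contradiction (x , x∉) none

  -- A copy of κ inside λ, and the disjoint cofinal cells.

  opaque
    ι : ∣ κ ∣ → ∣ Λ ∣
    ι = Injection.to (proj₁ κ≺Λ)

    ι-injective : ∀ {α β} → ι α ≡ ι β → α ≡ β
    ι-injective = Injection.injective (proj₁ κ≺Λ)

    α₀ : ∣ κ ∣
    α₀ = Injection.to (proj₁ regular) 0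

    bound : (a : PκΛ) → ∃ λ σ → ∀ β → ι β ∈ value a → β < σ
    bound a = bounded (value a ∘ ι) λ κ≼ → proj₂ (size a) (mk↣ {to = λ β → element (ι (value β)) (member β)}
      (λ eq → value-injective (ι-injective (cong value eq))) ↣-∘ κ≼)

  bound-∉ : ∀ a → ι (proj₁ (bound a)) ∉ value a
  bound-∉ a σ∈ = irrefl refl (proj₂ (bound a) _ σ∈)

  opaque
    tail : ∀ δ → ∣ κ ∣ ≼ El ⟨ (λ ε → δ < ε) ⟩
    tail δ = proj₂ regular _ λ α →
      -- The pair serves to take a maximum: a bound for its trace exceeds both `δ` and `α`.
      let a = ｛ ι δ ｝ₚ ∪ₚ ｛ ι α ｝ₚ
          σ , <σ = bound a
          δ<σ = <σ δ (∪ₚ⁺ˡ ｛ ι δ ｝ₚ ｛ ι α ｝ₚ _ (｛｝ₚ⁺ _))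
          α<σ = <σ α (∪ₚ⁺ʳ ｛ ι δ ｝ₚ ｛ ι α ｝ₚ _ (｛｝ₚ⁺ _))
      in σ , holds⁺ δ<σ , λ σ<α → irrefl refl (<-trans α<σ σ<α)

  succeed : ∣ κ ∣ → ∣ κ ∣ → ∣ κ ∣
  succeed δ α = value (Injection.to (tail δ) α)

  <-succeed : ∀ δ α → δ < succeed δ α
  <-succeed δ α = holds⁻ (member (Injection.to (tail δ) α))

  succeed-injective : ∀ δ {α β} → succeed δ α ≡ succeed δ β → α ≡ β
  succeed-injective δ eq = Injection.injective (tail δ) (value-injective eq)

  opaque
    -- The two largest elements δ < ε of the trace of b on κ code α as the
    -- position of ε in the tail of κ above δ.
    Codes : ∣ κ ∣ → PκΛ → Set ℓ
    Codes α b = ∃ λ δ → ι δ ∈ value b × ι (succeed δ α) ∈ value b ×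
      (∀ γ → ι γ ∈ value b → γ < δ ⊎ γ ≡ δ ⊎ γ ≡ succeed δ α)

    Cell : ∣ κ ∣ → 𝒫 PκΛ
    Cell α = ⟨ Codes α ⟩

    -- Take `δ` above the whole trace of `a` and add the points for `δ` and `succeed δ α`; these
    -- become the two largest elements of the trace.
    cell-cofinal : ∀ α (a : PκΛ) → ∃ λ (b : PκΛ) → b ∈ Cell α × value a ⊆ value b
    cell-cofinal α a = b , holds⁺ (δ , δ∈b , ε∈b , top) , ∪ₚ⁺ˡ a c
      where
      δ ε : ∣ κ ∣
      δ = proj₁ (bound a)
      ε = succeed δ α
      c b : PκΛ
      c = ｛ ι δ ｝ₚ ∪ₚ ｛ ι ε ｝ₚ
      b = a ∪ₚ c
      δ∈b : ι δ ∈ value b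
      δ∈b = ∪ₚ⁺ʳ a c _ (∪ₚ⁺ˡ ｛ ι δ ｝ₚ ｛ ι ε ｝ₚ _ (｛｝ₚ⁺ _))
      ε∈b : ι ε ∈ value b
      ε∈b = ∪ₚ⁺ʳ a c _ (∪ₚ⁺ʳ ｛ ι δ ｝ₚ ｛ ι ε ｝ₚ _ (｛｝ₚ⁺ _))
      top : ∀ γ → ι γ ∈ value b → γ < δ ⊎ γ ≡ δ ⊎ γ ≡ ε
      top γ γ∈b with ∪ₚ⁻ a c _ γ∈b
      ... | inj₁ γ∈a = inj₁ (proj₂ (bound a) γ γ∈a)
      ... | inj₂ γ∈c with ∪ₚ⁻ ｛ ι δ ｝ₚ ｛ ι ε ｝ₚ _ γ∈c
      ...   | inj₁ γ≡δ = inj₂ (inj₁ (ι-injective (｛｝ₚ⁻ γ≡δ)))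
      ...   | inj₂ γ≡ε = inj₂ (inj₂ (ι-injective (｛｝ₚ⁻ γ≡ε)))

    -- The largest element `ε` of the trace and the next largest `δ` depend on `b` alone, and
    -- injectivity of `succeed δ` recovers the code from them.
    codes-unique : ∀ {α β b} → Codes α b → Codes β b → α ≡ β
    codes-unique {α} {β} (δ , δ∈ , ε∈ , top) (δ′ , δ′∈ , ε′∈ , top′) =
      succeed-injective δ (trans ε≡ε′ (cong (λ δ → succeed δ β) (sym δ≡δ′)))
      where
      ε ε′ : ∣ κ ∣
      ε  = succeed δ α
      ε′ = succeed δ′ β
      largest : ∀ {γ} → γ < δ ⊎ γ ≡ δ ⊎ γ ≡ ε → γ < ε ⊎ γ ≡ ε
      largest (inj₁ γ<δ)         = inj₁ (<-trans γ<δ (<-succeed δ α))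
      largest (inj₂ (inj₁ refl)) = inj₁ (<-succeed δ α)
      largest (inj₂ (inj₂ γ≡ε))  = inj₂ γ≡ε
      largest′ : ∀ {γ} → γ < δ′ ⊎ γ ≡ δ′ ⊎ γ ≡ ε′ → γ < ε′ ⊎ γ ≡ ε′
      largest′ (inj₁ γ<δ)         = inj₁ (<-trans γ<δ (<-succeed δ′ β))
      largest′ (inj₂ (inj₁ refl)) = inj₁ (<-succeed δ′ β)
      largest′ (inj₂ (inj₂ γ≡ε))  = inj₂ γ≡ε
      ε≡ε′ : ε ≡ ε′
      ε≡ε′ with largest (top ε′ ε′∈) | largest′ (top′ ε ε∈)
      ... | inj₂ ε′≡ε | _         = sym ε′≡ε
      ... | inj₁ _    | inj₂ ε≡ε′ = ε≡ε′
      ... | inj₁ ε′<ε | inj₁ ε<ε′ = contradiction (<-trans ε′<ε ε<ε′) (irrefl refl)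
      δ≡δ′ : δ ≡ δ′
      δ≡δ′ with top δ′ δ′∈ | top′ δ δ∈
      ... | inj₂ (inj₁ δ′≡δ) | _                  = sym δ′≡δ
      ... | inj₂ (inj₂ δ′≡ε) | _                  = contradiction (<-succeed δ′ β) (irrefl (trans δ′≡ε ε≡ε′))
      ... | inj₁ _           | inj₂ (inj₁ δ≡δ′)   = δ≡δ′
      ... | inj₁ _           | inj₂ (inj₂ δ≡ε′)   = contradiction (<-succeed δ α) (irrefl (trans δ≡ε′ (sym ε≡ε′)))
      ... | inj₁ δ′<δ        | inj₁ δ<δ′          = contradiction (<-trans δ′<δ δ<δ′) (irrefl refl)

    cell-unique : ∀ {α β b} → b ∈ Cell α → b ∈ Cell β → α ≡ β
    cell-unique {α} {β} {b} b∈α b∈β = codes-unique {b = b} (holds⁻ b∈α) (holds⁻ b∈β)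

  -- Dominating families, and the two ideals with their cofinalities.

  -- The conditions inside `𝔡`, `𝔡‾`, `Cof` and `Cof‾` get names here so that `_⇝_` can relate them.
  Dominating : 𝒫 (∣ κ ∣ → PκΛ) → Set ℓ
  Dominating F = ∀ (g : ∣ κ ∣ → PκΛ) → ∃ λ f → f ∈ F × (∀ α → value (g α) ⊆ value (f α))

  Dominating‾ : 𝒫 (∣ κ ∣ → PκΛ) → Set ℓ
  Dominating‾ X = ∀ (g : ∣ κ ∣ → PκΛ) → ∃ λ x →
    x ∈P<[ κ ] X × (∀ α → value (g α) ⊆ (⋃[ f ∈ x ] value (f α)))

  Cofinal : 𝒫 (𝒫 PκΛ) → 𝒫 (𝒫 PκΛ) → Set ℓ
  Cofinal K X = X ⊆ K × (∀ B → B ∈ K ⇔ (∃ λ A → A ∈ X × B ⊆ A))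

  Cofinal‾ : 𝒫 (𝒫 PκΛ) → 𝒫 (𝒫 PκΛ) → Set ℓ
  Cofinal‾ K X = X ⊆ K × (∀ B → B ∈ K ⇔ (∃ λ x → x ∈P<[ κ ] X × B ⊆ ⋃ x))

  full-dominating : Dominating full
  full-dominating g = g , tt , λ _ _ → id

  full-dominating‾ : Dominating‾ full
  full-dominating‾ g = ｛ g ｝ , ((λ _ _ → tt) , countable-small (singleton-≼ g)) ,
    λ α x x∈g → holds⁺ {∃ λ f → f ∈ ｛ g ｝ × x ∈ value (f α)} (g , holds⁺ refl , x∈g)

  ∉⇒∈⁺ : {S : Set ℓ} {K : 𝒫 (𝒫 S)} {A : 𝒫 S} → A ∉ K → A ∈ K ⁺
  ∉⇒∈⁺ {K = K} {A} A∉K with K A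
  ... | true  = A∉K tt
  ... | false = tt

  ∈⁺⇒∉ : {S : Set ℓ} {K : 𝒫 (𝒫 S)} {A : 𝒫 S} → A ∈ K ⁺ → A ∉ K
  ∈⁺⇒∉ {K = K} {A} A∈K⁺ A∈K with true ← K A = A∈K⁺

  -- With d = false, K consists of the sets whose intersection with every cell
  -- is in I; with d = true, of those for which the set of exceptional cells is
  -- bounded. In the second case g codes the exceptions in its value at α₀, so
  -- that N g is monotone in g.
  module Ideal (d : Bool) where

    Exception : (∣ κ ∣ → PκΛ) → ∣ κ ∣ → Set
    Exception g α = T d × ι α ∈ value (g α₀)

    Avoids : (∣ κ ∣ → PκΛ) → PκΛ → Set ℓ
    Avoids g b = ∀ α → Exception g α ⊎ (b ∈ Cell α → ¬ (value (g α) ⊆ value b))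

    N : (∣ κ ∣ → PκΛ) → 𝒫 PκΛ
    N g = ⟨ Avoids g ⟩

    K : 𝒫 (𝒫 PκΛ)
    K = ⟨ (λ B → ∃ λ g → B ⊆ N g) ⟩

    N-mono : ∀ g h → (∀ α → value (g α) ⊆ value (h α)) → N g ⊆ N h
    N-mono g h g⊆h b b∈ = holds⁺ {Avoids h b} λ α → mono α (holds⁻ {Avoids g b} b∈ α)
      where
      mono : ∀ α → Exception g α ⊎ (b ∈ Cell α → ¬ (value (g α) ⊆ value b)) →
                   Exception h α ⊎ (b ∈ Cell α → ¬ (value (h α) ⊆ value b))
      mono α (inj₁ (td , α∈)) = inj₁ (td , g⊆h α₀ _ α∈)
      mono α (inj₂ avoids)    = inj₂ λ b∈α h⊆b → avoids b∈α λ x → h⊆b x ∘ g⊆h α x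

    N-∉⁺ : ∀ g {α b} → ¬ Exception g α → b ∈ Cell α → value (g α) ⊆ value b → b ∉ N g
    N-∉⁺ g {α} {b} ¬e b∈α g⊆b b∈N with holds⁻ {Avoids g b} b∈N α
    ... | inj₁ e      = ¬e e
    ... | inj₂ avoids = avoids b∈α g⊆b

    N-∉⁻ : ∀ g {b} → b ∉ N g → ∃ λ α → ¬ Exception g α × b ∈ Cell α × value (g α) ⊆ value b
    N-∉⁻ g {b} b∉N = dne λ none → b∉N (holds⁺ {Avoids g b} λ α → avoids none α)
      where
      avoids : ¬ (∃ λ α → ¬ Exception g α × b ∈ Cell α × value (g α) ⊆ value b) →
        ∀ α → Exception g α ⊎ (b ∈ Cell α → ¬ (value (g α) ⊆ value b))
      avoids none α with em {Lift ℓ (Exception g α)}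
      ... | yes (lift e) = inj₁ e
      ... | no ¬e        = inj₂ λ b∈α g⊆b → none (α , ¬e ∘ lift , b∈α , g⊆b)

    N∈K : ∀ g → N g ∈ K
    N∈K g = holds⁺ (g , λ _ → id)

    downward : ∀ A B → A ⊆ B → B ∈ K → A ∈ K
    downward A B A⊆B B∈K with holds⁻ B∈K
    ... | g , B⊆N = holds⁺ (g , λ b → B⊆N b ∘ A⊆B b)

    fine : I ⊆ K
    fine A A∈I with holds⁻ A∈I
    ... | a , none = holds⁺ ((λ _ → a) , λ b b∈A → holds⁺ {Avoids (λ _ → a) b} λ α → inj₂ λ _ a⊆b →
      none b (Equivalence.from T-∧ (b∈A , holds⁺ a⊆b)))

    -- The pointwise union of fewer than κ witnesses is again a witness, by `N-mono`. An indexed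
    -- family covers both binary unions and κ-completeness.
    union-closed : {J : Set ℓ} (A : J → 𝒫 PκΛ) → J ≺ ∣ κ ∣ → (∀ j → A j ∈ K) →
      ∀ B → (∀ b → b ∈ B → ∃ λ j → b ∈ A j) → B ∈ K
    union-closed {J} A J≺κ A∈K B B⊆⋃A = holds⁺ (g , λ b b∈B → let j , b∈A = B⊆⋃A b b∈B in
        N-mono (proj₁ (cover j)) g (λ α → ⋃ₚ⁺ (λ j → proj₁ (cover j) α) j) b (proj₂ (cover j) b b∈A))
      where
      cover : ∀ j → ∃ λ g → A j ⊆ N g
      cover j = holds⁻ (A∈K j)
      g : ∣ κ ∣ → PκΛ
      g α = ⋃ₚ J≺κ λ j → proj₁ (cover j) α

    complete : ∀ X → X ∈P<[ κ ] K → ⋃ X ∈ K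
    complete X (X⊆K , X≺κ) = union-closed {El X} value X≺κ (λ A → X⊆K _ (member A)) (⋃ X) split
      where
      split : ∀ b → b ∈ ⋃ X → ∃ λ (A : El X) → b ∈ value A
      split b b∈ with holds⁻ b∈
      ... | A , A∈X , b∈A = element A A∈X , b∈A

    -- No set that contains a point outside `s` equals `s`, so the singleton is in `I`.
    singletons : ∀ s → ｛ s ｝ ∈ K
    singletons s = fine ｛ s ｝ (holds⁺ (｛ proj₁ (fresh s) ｝ₚ , none))
      where
      none : ∀ b → b ∉ ｛ s ｝ ∩ Above ｛ proj₁ (fresh s) ｝ₚ
      none b b∈ with Equivalence.to (T-∧ {｛ s ｝ b}) b∈
      ... | b∈s , b∈above with holds⁻ b∈s
      ...   | refl = proj₂ (fresh s) (holds⁻ {value ｛ proj₁ (fresh s) ｝ₚ ⊆ value b} b∈above _ (｛｝ₚ⁺ _))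

    unions : ∀ A B → A ∈ K → B ∈ K → (A ∪ B) ∈ K
    unions A B A∈K B∈K = union-closed pair Two-small pair∈K (A ∪ B) split
      where
      pair : Lift ℓ Bool → 𝒫 PκΛ
      pair c = if lower c then A else B
      pair∈K : ∀ c → pair c ∈ K
      pair∈K (lift true)  = A∈K
      pair∈K (lift false) = B∈K
      split : ∀ b → b ∈ A ∪ B → ∃ λ c → b ∈ pair c
      split b b∈ with Equivalence.to (T-∨ {A b}) b∈
      ... | inj₁ b∈A = lift true  , b∈A
      ... | inj₂ b∈B = lift false , b∈B

    proper : full ∉ K
    proper full∈K with holds⁻ full∈K
    ... | g , full⊆N =
      -- `σ` bounds the coded exceptions, so it is not one of them, and its cell has an element
      -- containing `g σ`. This works for both values of `d`.
      let σ = proj₁ (bound (g α₀))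
          b , b∈σ , g⊆b = cell-cofinal σ (g σ)
      in N-∉⁺ g (bound-∉ (g α₀) ∘ proj₂) b∈σ g⊆b (full⊆N b tt)

    isIdealOnPκΛ : IsIdealOnPκΛ K
    isIdealOnPκΛ = record
      { isIdeal = record { singletons = singletons ; downward = downward ; unions = unions ; proper = proper }
      ; complete = complete
      ; fine = fine
      }

    dominating⇝cofinal : Dominating ⇝ Cofinal K
    dominating⇝cofinal F dom = image N F , (image⊆K , λ B → mk⇔ (cover B) (covered B)) , image-≼ N F
      where
      image⊆K : image N F ⊆ K
      image⊆K A A∈ with holds⁻ A∈
      ... | g , _ , refl = N∈K g
      cover : ∀ B → B ∈ K → ∃ λ A → A ∈ image N F × B ⊆ A
      cover B B∈K with holds⁻ B∈K
      ... | g , B⊆N with dom g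
      ...   | f , f∈F , g⊆f = N f , holds⁺ (f , f∈F , refl) , λ b → N-mono g f g⊆f b ∘ B⊆N b
      covered : ∀ B → (∃ λ A → A ∈ image N F × B ⊆ A) → B ∈ K
      covered B (A , A∈ , B⊆A) = downward B A B⊆A (image⊆K A A∈)

    -- Above an index σ > α that is not an exception, every element of the
    -- cell σ that contains g σ escapes N g.
    cofinal⇝dominating : Cofinal K ⇝ Dominating
    cofinal⇝dominating X (X⊆K , cofinal) = image escape X , dominating , image-≼ escape X
      where
      index : 𝒫 PκΛ → ∣ κ ∣ → PκΛ
      index A with em {∃ λ g → A ⊆ N g}
      ... | yes (g , _) = g
      -- Default value for sets outside `K`; members of `X` never reach it.
      ... | no _        = λ _ → ｛ ι α₀ ｝ₚ
      ⊆-index : ∀ A → A ∈ K → A ⊆ N (index A)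
      ⊆-index A A∈K with em {∃ λ g → A ⊆ N g}
      ... | yes (_ , A⊆N) = A⊆N
      -- Adding `ι α` to the coded exceptions pushes the bound `σ A α` above `α` as well.
      later : 𝒫 PκΛ → ∣ κ ∣ → PκΛ
      later A α = index A α₀ ∪ₚ ｛ ι α ｝ₚ
      σ : 𝒫 PκΛ → ∣ κ ∣ → ∣ κ ∣
      σ A α = proj₁ (bound (later A α))
      escape : 𝒫 PκΛ → ∣ κ ∣ → PκΛ
      escape A α = proj₁ (cell-cofinal (σ A α) (index A (σ A α)))
      dominating : Dominating (image escape X)
      dominating g = escape A , holds⁺ (A , A∈X , refl) , g⊆escape
        where
        -- `escape A α` lies in the cell of `σ A α`, not of `α`, so the function to be covered must
        -- collect at each index all earlier values of `g`.
        g↑ : ∣ κ ∣ → PκΛ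
        g↑ α = ⋃ₚ (Below-small α) (g ∘ value)
        covering = Equivalence.to (cofinal (N g↑)) (N∈K g↑)
        A = proj₁ covering
        A∈X = proj₁ (proj₂ covering)
        N⊆A = proj₂ (proj₂ covering)
        g⊆escape : ∀ α → value (g α) ⊆ value (escape A α)
        -- Outside `N g↑`, the set `b` contains `g↑ β` for its own cell `β`, which is `σ A α`; as
        -- `α` is smaller, `g α` is a part of that union.
        g⊆escape α x x∈g = let β , _ , b∈β , g↑⊆b = N-∉⁻ g↑ b∉N in
            subst (λ β → value (g↑ β) ⊆ value b) (sym (cell-unique b∈σ b∈β)) g↑⊆b x
              (⋃ₚ⁺ (g ∘ value) (α , [ α<σ ]) x x∈g)
          where
          b = escape A α
          b∈σ : b ∈ Cell (σ A α)
          b∈σ = proj₁ (proj₂ (cell-cofinal (σ A α) (index A (σ A α))))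
          α<σ : α < σ A α
          α<σ = proj₂ (bound (later A α)) α (∪ₚ⁺ʳ (index A α₀) ｛ ι α ｝ₚ _ (｛｝ₚ⁺ _))
          ¬exception : ¬ Exception (index A) (σ A α)
          ¬exception (_ , σ∈) = bound-∉ (later A α) (∪ₚ⁺ˡ (index A α₀) ｛ ι α ｝ₚ _ σ∈)
          b∉N : b ∉ N g↑
          b∉N b∈N = N-∉⁺ (index A) ¬exception b∈σ (proj₂ (proj₂ (cell-cofinal (σ A α) (index A (σ A α)))))
            (⊆-index A (X⊆K A A∈X) b (N⊆A b b∈N))

    -- A point outside N f for all f ∈ x lies in a single cell, which makes
    -- the union over x pointwise.
    N-⋃ : ∀ g {b} (x : 𝒫 (∣ κ ∣ → PκΛ)) → ∃ (_∈ x) → (∀ α → value (g α) ⊆ (⋃[ f ∈ x ] value (f α))) →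
      b ∈ N g → b ∈ ⋃ (image N x)
    N-⋃ g {b} x (f₀ , f₀∈x) g⊆⋃ b∈N = holds⁺ (dne λ none → none-absurd none)
      where
      none-absurd : ¬ ¬ (∃ λ A → A ∈ image N x × b ∈ A)
      none-absurd none = N-∉⁺ g ¬exception b∈α g⊆b b∈N
        where
        outside : ∀ f → f ∈ x → ∃ λ α → ¬ Exception f α × b ∈ Cell α × value (f α) ⊆ value b
        outside f f∈x = N-∉⁻ f λ b∈Nf → none (N f , holds⁺ (f , f∈x , refl) , b∈Nf)
        α = proj₁ (outside f₀ f₀∈x)
        b∈α = proj₁ (proj₂ (proj₂ (outside f₀ f₀∈x)))
        outside-α : ∀ f → f ∈ x → ¬ Exception f α × value (f α) ⊆ value b
        outside-α f f∈x with outside f f∈x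
        ... | β , ¬e , b∈β , f⊆b with cell-unique b∈α b∈β
        ...   | refl = ¬e , f⊆b
        ¬exception : ¬ Exception g α
        ¬exception (td , α∈) with holds⁻ (g⊆⋃ α₀ _ α∈)
        ... | f , f∈x , α∈f = proj₁ (outside-α f f∈x) (td , α∈f)
        g⊆b : value (g α) ⊆ value b
        g⊆b y y∈ with holds⁻ (g⊆⋃ α y y∈)
        ... | f , f∈x , y∈f = proj₂ (outside-α f f∈x) y y∈f

    dominating‾⇝cofinal‾ : Dominating‾ ⇝ Cofinal‾ K
    dominating‾⇝cofinal‾ X dom = image N X , (image⊆K , λ B → mk⇔ (cover B) (covered B)) , image-≼ N X
      where
      image⊆K : image N X ⊆ K
      image⊆K A A∈ with holds⁻ A∈
      ... | g , _ , refl = N∈K g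
      cover : ∀ B → B ∈ K → ∃ λ x → x ∈P<[ κ ] image N X × B ⊆ ⋃ x
      cover B B∈K with holds⁻ B∈K
      -- The extra point `ι α₀` forces the covering family `x` to be nonempty, as `N-⋃` requires;
      -- enlarging `g` only enlarges `N g`.
      ... | g , B⊆N with dom (λ α → g α ∪ₚ ｛ ι α₀ ｝ₚ)
      ...   | x , (x⊆X , x≺κ) , g⊆⋃ =
        image N x , (image⊆ , ≼-small (image-≼ N x) x≺κ) ,
        λ b b∈B → N-⋃ g⁺ x inhabited g⊆⋃ (N-mono g g⁺ (λ α → ∪ₚ⁺ˡ (g α) ｛ ι α₀ ｝ₚ) b (B⊆N b b∈B))
        where
        g⁺ : ∣ κ ∣ → PκΛ
        g⁺ α = g α ∪ₚ ｛ ι α₀ ｝ₚ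
        image⊆ : image N x ⊆ image N X
        image⊆ A A∈ with holds⁻ A∈
        ... | f , f∈x , eq = holds⁺ (f , x⊆X f f∈x , eq)
        inhabited : ∃ (_∈ x)
        inhabited with holds⁻ (g⊆⋃ α₀ _ (∪ₚ⁺ʳ (g α₀) ｛ ι α₀ ｝ₚ (ι α₀) (｛｝ₚ⁺ _)))
        ... | f , f∈x , _ = f , f∈x
      covered : ∀ B → (∃ λ x → x ∈P<[ κ ] image N X × B ⊆ ⋃ x) → B ∈ K
      covered B (x , (x⊆ , x≺κ) , B⊆⋃) = downward B (⋃ x) B⊆⋃ (complete x ((λ A → image⊆K A ∘ x⊆ A) , x≺κ))

    cof : ∃ λ μ → Cof K μ × 𝔡 μ
    cof =
      let μ , 𝔡-μ = leastCard-exists {Φ = Dominating} (full , full-dominating)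
      in μ , leastCard-transfer {Φ = Dominating} {Ψ = Cofinal K} {μ} dominating⇝cofinal cofinal⇝dominating 𝔡-μ , 𝔡-μ

    cof‾ : ∃ λ μ → ∃ λ ν → Cof‾ K μ × 𝔡‾ ν × ∣ μ ∣ ≼ ∣ ν ∣
    cof‾ =
      let ν , 𝔡‾-ν = leastCard-exists {Φ = Dominating‾} (full , full-dominating‾)
          X , X-cofinal , _ = dominating‾⇝cofinal‾ full full-dominating‾
          μ , cof‾-μ = leastCard-exists {Φ = Cofinal‾ K} (X , X-cofinal)
      in μ , ν , cof‾-μ , 𝔡‾-ν , leastCard-≼ {Φ = Dominating‾} {Ψ = Cofinal‾ K} {ν} {μ} dominating‾⇝cofinal‾ 𝔡‾-ν cof‾-μ

  -- The cells as a maximal almost disjoint family for `H`, and as a counterexample for `K`.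

  module H = Ideal false
  module K = Ideal true

  Cell∉H : ∀ α → Cell α ∉ H.K
  Cell∉H α Cell∈H with holds⁻ Cell∈H
  ... | g , Cell⊆N with cell-cofinal α (g α)
  -- `H` has no exceptional cells: `T false` is empty, so `proj₁` refutes an exception.
  ...   | b , b∈α , g⊆b = H.N-∉⁺ g proj₁ b∈α g⊆b (Cell⊆N b b∈α)

  Cells : 𝒫 (𝒫 PκΛ)
  Cells = image Cell full

  κ≼Cells : ∣ κ ∣ ≼ El Cells
  κ≼Cells = mk↣ {to = λ α → element (Cell α) (holds⁺ (α , tt , refl))} λ {α} {β} eq →
    -- Cofinality over an arbitrary set is used only to obtain an element of the cell.
    let b , b∈α , _ = cell-cofinal α ｛ ι α₀ ｝ₚ
    in cell-unique b∈α (subst (b ∈_) (cong value eq) b∈α)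

  Cells≼κ : El Cells ≼ ∣ κ ∣
  Cells≼κ = mk↣ {to = value} value-injective ↣-∘ image-≼ Cell full

  Cells-𝓜 : 𝓜≥κ H.K Cells
  Cells-𝓜 = record
    { positive       = positive
    ; large          = κ≼Cells
    ; almostDisjoint = almostDisjoint
    ; maximal        = maximal
    }
    where
    positive : Cells ⊆ H.K ⁺
    positive A A∈ with holds⁻ A∈
    ... | α , _ , refl = ∉⇒∈⁺ {K = H.K} {Cell α} (Cell∉H α)
    almostDisjoint : ∀ A B → A ∈ Cells → B ∈ Cells → A ≢ B → (A ∩ B) ∈ H.K
    almostDisjoint A B A∈ B∈ A≢B with holds⁻ A∈ | holds⁻ B∈
    -- Distinct cells are disjoint, so any function witnesses that the intersection is small.
    ... | α , _ , refl | β , _ , refl = holds⁺ ((λ _ → ｛ ι α₀ ｝ₚ) , λ b b∈ →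
      let b∈α , b∈β = Equivalence.to (T-∧ {Cell α b}) b∈
      in contradiction (cong Cell (cell-unique b∈α b∈β)) A≢B)
    maximal : ∀ C → C ∈ H.K ⁺ → ∃ λ A → A ∈ Cells × (A ∩ C) ∈ H.K ⁺
    maximal C C∈⁺ = dne λ none → ∈⁺⇒∉ {K = H.K} {C} C∈⁺ (C∈K none)
      where
      C∈K : ¬ (∃ λ A → A ∈ Cells × (A ∩ C) ∈ H.K ⁺) → C ∈ H.K
      C∈K none = holds⁺ (g , λ b b∈C → holds⁺ {H.Avoids g b} λ α →
          inj₂ λ b∈α g⊆b → H.N-∉⁺ (proj₁ (cover α)) proj₁ b∈α g⊆b
            (proj₂ (cover α) b (Equivalence.from T-∧ (b∈α , b∈C))))
        where
        cover : ∀ α → ∃ λ g → Cell α ∩ C ⊆ H.N g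
        cover α with ∈-dec (Cell α ∩ C) H.K
        ... | inj₁ ∈K = holds⁻ ∈K
        ... | inj₂ ∉K = contradiction (Cell α , holds⁺ (α , tt , refl) , ∉⇒∈⁺ {K = H.K} {Cell α ∩ C} ∉K) none
        g : ∣ κ ∣ → PκΛ
        -- The diagonal: on the cell of `α`, only the value at `α` of the function for `Cell α ∩ C`
        -- matters.
        g α = proj₁ (cover α) α

  -- The lower bound is the clause `large`; the cells attain it.
  𝔞-H : 𝔞 H.K κ
  𝔞-H = inj₁ ((Cells , Cells-𝓜 , cantor-bernstein Cells≼κ κ≼Cells) , λ _ → 𝓜≥κ.large)

  Cell∈K : ∀ α → Cell α ∈ K.K
  Cell∈K α = holds⁺ (g , λ b b∈α → holds⁺ {K.Avoids g b} λ β → avoids b b∈α β)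
    where
    g : ∣ κ ∣ → PκΛ
    -- The value at `α₀` declares `α` the sole exception; elements of `Cell α` lie in no other cell.
    g _ = ｛ ι α ｝ₚ
    avoids : ∀ b → b ∈ Cell α → ∀ β → K.Exception g β ⊎ (b ∈ Cell β → ¬ (value (g β) ⊆ value b))
    avoids b b∈α β with em {β ≡ α}
    ... | yes refl = inj₁ (tt , ｛｝ₚ⁺ (ι β))
    ... | no β≢α   = inj₂ λ b∈β → contradiction (cell-unique b∈β b∈α) β≢α

  K-not-weakπPoint : ¬ WeakπPoint K.K
  K-not-weakπPoint weak with weak Cell Cell∈K full (∉⇒∈⁺ {K = K.K} {full} K.proper)
  ... | B , B∈⁺ , _ , B∩Cell∈I = ∈⁺⇒∉ {K = K.K} {B} B∈⁺
    (holds⁺ (g , λ b b∈B → holds⁺ {K.Avoids g b} λ α → inj₂ λ b∈α g⊆b →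
      proj₂ (avoid α) b (Equivalence.from T-∧ (Equivalence.from T-∧ (b∈B , b∈α) , holds⁺ g⊆b))))
    where
    avoid : ∀ α → ∃ λ a → ∀ b → b ∉ (B ∩ Cell α) ∩ Above a
    avoid α = holds⁻ (B∩Cell∈I α)
    g : ∣ κ ∣ → PκΛ
    -- Since `B ∩ Cell α` misses the cone above `g α` for every `α`, all of `B` lies in `N g`,
    -- against its positivity.
    g α = proj₁ (avoid α)

theorem8p6 : ∀ {ℓ} (em : ExcludedMiddle ℓ) → Extensionality ℓ ℓ →
    (κ Λ : Cardinal ℓ) → Regular κ → Uncountable κ → ∣ κ ∣ ≺ ∣ Λ ∣ →
    let open Classical em
        open Pκλ κ Λ in
    (∃ λ H → IsIdealOnPκΛ H
      × 𝔞 H κ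
      × (∃ λ μ → Cof H μ × 𝔡 μ)
      × (∃ λ μ → ∃ λ ν → Cof‾ H μ × 𝔡‾ ν × ∣ μ ∣ ≼ ∣ ν ∣))
    × (∃ λ K → IsIdealOnPκΛ K
      × ¬ WeakπPoint K
      × (∃ λ μ → Cof K μ × 𝔡 μ)
      × (∃ λ μ → ∃ λ ν → Cof‾ K μ × 𝔡‾ ν × ∣ μ ∣ ≼ ∣ ν ∣))
theorem8p6 em ext κ Λ regular uncountable κ≺Λ =
    (H.K , H.isIdealOnPκΛ , 𝔞-H , H.cof , H.cof‾)
  , (K.K , K.isIdealOnPκΛ , K-not-weakπPoint , K.cof , K.cof‾)
  where open Construction em ext κ Λ regular uncountable κ≺Λ
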